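{- Let $\alpha=(\alpha_1,\dots,\alpha_k)$ be a peak composition of $n$. The DIRT-generating procedure (described in the context), applied to $\alpha$, generates all dual immaculate recording tableaux of peak shape with row strip shape $\alpha^{\mathrm{rev}}$; that is, the set of fillings containing all of $1,\dots,n$ that it produces is the set of all dual immaculate recording tableaux whose shape is a peak composition and whose row strip shape is $\alpha^{\mathrm{rev}}$.
   Context: Let $n$ be a positive integer, $[n]=\{1,\dots,n\}$. A composition $\alpha=(\alpha_1,\dots,\alpha_k)$ of $n$ is a finite sequence of positive integers summing to $n$; $\alpha^{\mathrm{rev}}=(\alpha_k,\dots,\alpha_1)$. It is a peak composition if all parts except possibly the last are greater than $1$. The diagram $D_\alpha$ is the left-justified array of boxes whose $i$th row from the bottom has $\alpha_i$ boxes; $(c,r)$ denotes the box in column $c$ (leftmost is 1) and row $r$ (bottom is 1). A filling $Q$ of $D_\alpha$ assigns an entry $Q(c,r)$ to each box; $\alpha$ is its shape, and $Q$ has peak shape if $\alpha$ is a peak composition. Dual immaculate recording tableaux: for a filling $Q$ of a composition diagram with entries from $[n]$, each used once, a row strip of length $j$ is a maximal sequence $a_1,\dots,a_j$ of consecutive increasing integers such that for all $1\le i<j$, $a_{i+1}$ is in a column strictly right of that of $a_i$. For a composition $\beta$ of $n$, a filling $Q$ of $D_\beta$ with entries from $[n]$, each used once, is a dual immaculate recording tableau (DIRT) if: (1) entries in each row increase left to right; (2) the row strips start in the first column; (3) entries in the first column increase from top to bottom; (4) if $Q(c,r)>Q(c,r')$ for some $c$ and some $r'<r$, then $Q$ has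 an entry in box $(c+1,r')$ and $Q(c,r)>Q(c+1,r')$. Its row strip shape is the composition $(\gamma_1,\dots,\gamma_k)$ where $\gamma_i$ is the length of the row strip starting with $\gamma_1+\cdots+\gamma_{i-1}+1$. DIRT-generating procedure for a peak composition $\alpha=(\alpha_1,\dots,\alpha_k)$ of $n$: start with the one-row filling with entries $1,2,\dots,\alpha_k$ from left to right (the unique DIRT of peak shape with row strip shape $(\alpha_k)^{\mathrm{rev}}$). For $i=1,2,\dots,k-1$ in turn, perform the following on every filling $Q$ created at the previous step (each being a DIRT of peak shape with row strip shape $(\alpha_{k-i+1},\dots,\alpha_k)^{\mathrm{rev}}$). Let $m$ be the largest entry of $Q$. Assign the entries $m+1,m+2,\dots,m+\alpha_{k-i}$ sequentially to $Q$ in each possible way according to the rules: (1) the entries $m+1$ and $m+2$ become the first two entries of a new bottom row of $Q$ (note $\alpha_{k-i}\ge 2$); (2) each subsequent entry is placed at the end of a row, in a position strictly to the right (i.e. in a strictly greater column) of the last entry placed; (3) no entry can be placed at the end of a row of (current) length $j$ if there exists a row of (current) length $j+1$ below this row. The procedure ends when the entry $n$ has been assigned in each filling; these fillings are the ones generated. -}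

module Defs where

open import Data.Fin.Base using (Fin; toℕ)
open import Data.List.Base
  using (List; []; _∷_; _++_; _∷ʳ_; applyUpTo; concat; length; lookup; map; sum; take)
open import Data.List.Extrema.Nat using (max)
open import Data.List.Relation.Binary.Permutation.Propositional using (_↭_)
open import Data.List.Relation.Unary.All using (All)
open import Data.Nat.Base using (ℕ; suc; _+_; _≤_; _<_)
open import Data.Product.Base using (_×_; ∃-syntax)
open import Relation.Binary.PropositionalEquality.Core using (_≡_; _≢_)

record IsComposition (n : ℕ) (α : List ℕ) : Set where
  field
    positive : All (0 <_) α
    total    : sum α ≡ n

IsPeak : List ℕ → Set
IsPeak α = ∀ (i : Fin (length α)) → suc (toℕ i) < length α → 1 < lookup α i

[1⋯_] : ℕ → List ℕ
[1⋯ n ] = applyUpTo suc n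

-- A filling is the list of its rows from bottom to top, each row being listed
-- from left to right; rows and columns are numbered from 1.
Filling : Set
Filling = List (List ℕ)

shape : Filling → List ℕ
shape = map length

data _at_is_ {A : Set} : List A → ℕ → A → Set where
  here  : ∀ {x xs} → (x ∷ xs) at 1 is x
  there : ∀ {x y xs i} → xs at i is x → (y ∷ xs) at suc i is x

-- Box (c , r), column first, belongs to the diagram of Q and holds the entry x.
_[_,_]=_ : Filling → ℕ → ℕ → ℕ → Set
Q [ c , r ]= x = ∃[ row ] (Q at r is row × row at c is x)

InColumn : Filling → ℕ → ℕ → Set
InColumn Q x c = ∃[ r ] Q [ c , r ]= x

-- The sequence a, a+1, …, a+j−1 of entries of Q, each one after the first lying
-- in a column strictly to the right of its predecessor's.
record IsRun (Q : Filling) (a j : ℕ) : Set where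
  field
    nonempty  : 0 < j
    entries   : ∀ i → i < j → ∃[ c ] InColumn Q (a + i) c
    rightward : ∀ i → suc i < j →
                ∃[ c ] ∃[ d ] (InColumn Q (a + i) c × InColumn Q (a + suc i) d × c < d)

record IsRowStrip (Q : Filling) (a j : ℕ) : Set where
  field
    isRun   : IsRun Q a j
    maximal : ∀ b l → IsRun Q b l → b ≤ a → a + j ≤ b + l → b ≡ a × l ≡ j

record IsDIRT (n : ℕ) (Q : Filling) : Set where
  field
    composition : IsComposition n (shape Q)
    standard    : concat Q ↭ [1⋯ n ]
    rows        : ∀ {c d r x y} → Q [ c , r ]= x → Q [ d , r ]= y → c < d → x < y
    strips      : ∀ {a j} → IsRowStrip Q a j → InColumn Q a 1
    firstColumn : ∀ {r s x y} → Q [ 1 , r ]= x → Q [ 1 , s ]= y → s < r → x < y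
    triple      : ∀ {c r s x y} → Q [ c , r ]= x → Q [ c , s ]= y → s < r → y < x →
                  ∃[ z ] (Q [ suc c , s ]= z × z < x)

record HasRowStripShape (n : ℕ) (Q : Filling) (γ : List ℕ) : Set where
  field
    composition : IsComposition n γ
    strip       : ∀ (i : Fin (length γ)) →
                  IsRowStrip Q (suc (sum (take (toℕ i) γ))) (lookup γ i)

-- Place x c Q d Q′: the last entry was placed in column c, and Q′ results from
-- putting x in column d at the end of a row of Q.  The list `below` holds the rows
-- beneath the chosen one.
data Place (x c : ℕ) : Filling → ℕ → Filling → Set where
  place : ∀ below row above →
          c < suc (length row) →
          All (λ ρ → length ρ ≢ suc (length row)) below →
          Place x c (below ++ row ∷ above) (suc (length row)) (below ++ (row ∷ʳ x) ∷ above)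

-- PlaceMany x l c Q Q′: the entries x, x+1, …, x+l−1 are placed one after the
-- other, starting from Q with the last entry in column c and ending at Q′.
data PlaceMany : ℕ → ℕ → ℕ → Filling → Filling → Set where
  done : ∀ {x c Q} → PlaceMany x 0 c Q Q
  next : ∀ {x l c d Q Q′ Q″} → Place x c Q d Q′ → PlaceMany (suc x) l d Q′ Q″ →
         PlaceMany x (suc l) c Q Q″

-- Step p Q Q′: one round of the procedure, for a part p = l + 2, turns Q into Q′.
data Step : ℕ → Filling → Filling → Set where
  step : ∀ {l Q Q′} → let m = max 0 (concat Q) in
         PlaceMany (3 + m) l 2 ((1 + m ∷ 2 + m ∷ []) ∷ Q) Q′ →
         Step (2 + l) Q Q′

-- Generated α Q: the procedure applied to α produces Q.  The parts of α are
-- consumed from the last to the first.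
data Generated : List ℕ → Filling → Set where
  start : ∀ {p} → Generated (p ∷ []) ([1⋯ p ] ∷ [])
  round : ∀ {p q α Q Q′} → Generated (q ∷ α) Q → Step p Q Q′ →
          Generated (p ∷ q ∷ α) Q′

{-# OPTIONS --safe #-}
module Submission where

-- Adding one entry larger than all others at the end of a row preserves the ordering
-- axioms of a DIRT exactly when rule (3) holds: a lower row ending in the new entry's
-- column would violate the triple condition there. Row strips start in column 1 and
-- move strictly to the right, so a standard filling has the required row strips iff,
-- inside each strip, the columns increase from column 1; this is what rules (1) and (2)
-- produce. Conversely, let m + 1 start the last strip of a DIRT of peak shape. It is the
-- first entry of the bottom row, as first-column entries increase downwards and no later
-- entry of the strip lies in column 1. The bottom row has a second entry, which
-- belongs to the same strip; since the columns of the strip increase, it is m + 2 and no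
-- other entry of the strip lies in column 2. Hence deleting the strip keeps the peak
-- shape, and induction on the number of strips applies.

open import Defs
open import Data.Empty using (⊥; ⊥-elim)
open import Data.Fin.Base using (Fin; zero; suc; toℕ)
open import Data.List.Base
  using (List; []; _∷_; _++_; _∷ʳ_; concat; filter; length; lookup; map; reverse; take)
open import Data.List.Extrema.Nat using (max; max≈v⁺)
open import Data.List.Membership.Propositional using (_∈_)
open import Data.List.Membership.Propositional.Properties
  using (∈-++⁺ˡ; ∈-++⁺ʳ; ∈-++⁻; ∈-applyUpTo⁺; ∈-applyUpTo⁻)
open import Data.List.Properties
  using ( applyUpTo-∷ʳ; filter-accept; filter-all; filter-none; filter-reject; filter-++; length-++
        ; length-applyUpTo; map-++; unfold-reverse; ++-assoc; ++-identityʳ )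
open import Data.List.Relation.Binary.Permutation.Propositional
  using (_↭_; ↭-refl; ↭-sym; ↭-trans; ↭⇒↭ₛ; ↭-reflexive; prep)
open import Data.List.Relation.Binary.Permutation.Propositional.Properties
  using (∈-resp-↭; shift; ++⁺ˡ; ∷↭∷ʳ; ↭-length; ↭-reverse; All-resp-↭)
open import Data.List.Relation.Binary.Permutation.Setoid.Properties using (Unique-resp-↭)
open import Data.List.Relation.Unary.All as All using (All; []; _∷_)
open import Data.List.Relation.Unary.AllPairs using (AllPairs; []; _∷_)
open import Data.List.Relation.Unary.Any using (here; there)
open import Data.List.Relation.Unary.Unique.Propositional using (Unique)
open import Data.List.Relation.Unary.Unique.Propositional.Properties using (applyUpTo⁺₁)
open import Data.Nat.Base using (ℕ; zero; suc; _+_; _∸_; _≤_; _<_; z≤n; s≤s; s≤s⁻¹)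
open import Data.Nat.ListAction using (sum)
open import Data.Nat.ListAction.Properties using (sum-↭)
open import Data.Nat.Properties
open import Data.Product.Base using (_×_; _,_; ∃-syntax; proj₁; proj₂)
open import Data.Sum.Base using (_⊎_; inj₁; inj₂)
open import Function.Base using (_∘_)
open import Function.Bundles using (_⇔_; mk⇔)
open import Relation.Binary.PropositionalEquality
  using (_≡_; _≢_; refl; sym; trans; cong; cong₂; subst; subst₂; setoid; module ≡-Reasoning)
open import Relation.Nullary using (yes; no; contradiction)

private
  variable
    A B : Set
    x y a b c d e i j k l m n p q r s : ℕ
    row : List ℕ
    α δ γ : List ℕ
    Q Q′ Q″ : Filling

-- Positions in lists

at-positive : {u : A} {xs : List A} → xs at i is u → 0 < i
at-positive here      = s≤s z≤n
at-positive (there _) = s≤s z≤n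

at-functional : {u v : A} {xs : List A} → xs at i is u → xs at i is v → u ≡ v
at-functional here      here      = refl
at-functional here      (there q) = contradiction (at-positive q) λ ()
at-functional (there p) here      = contradiction (at-positive p) λ ()
at-functional (there p) (there q) = at-functional p q

at⇒∈ : {u : A} {xs : List A} → xs at i is u → u ∈ xs
at⇒∈ here      = here refl
at⇒∈ (there p) = there (at⇒∈ p)

∈⇒at : {u : A} {xs : List A} → u ∈ xs → ∃[ i ] xs at i is u
∈⇒at (here refl) = 1 , here
∈⇒at (there u∈)  = let i , p = ∈⇒at u∈ in suc i , there p

at-≤-length : {u : A} {xs : List A} → xs at i is u → i ≤ length xs
at-≤-length here      = s≤s z≤n
at-≤-length (there p) = s≤s (at-≤-length p)

at-exists : (xs : List A) → 0 < i → i ≤ length xs → ∃[ u ] xs at i is u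
at-exists {i = suc zero}    (u ∷ xs) _ _         = u , here
at-exists {i = suc (suc i)} (_ ∷ xs) _ (s≤s i≤) =
  let u , p = at-exists xs (s≤s z≤n) i≤ in u , there p

at-++ˡ : {u : A} {xs ys : List A} → xs at i is u → (xs ++ ys) at i is u
at-++ˡ here      = here
at-++ˡ (there p) = there (at-++ˡ p)

at-++ʳ : {u : A} (xs : List A) {ys : List A} → ys at i is u → (xs ++ ys) at (length xs + i) is u
at-++ʳ []       p = p
at-++ʳ (_ ∷ xs) p = there (at-++ʳ xs p)

at-middle : {u : A} (xs : List A) {ys : List A} → (xs ++ u ∷ ys) at suc (length xs) is u
at-middle []       = here
at-middle (_ ∷ xs) = there (at-middle xs)

at-split : {u : A} {xs : List A} → xs at i is u →
           ∃[ ys ] ∃[ zs ] (xs ≡ ys ++ u ∷ zs × i ≡ suc (length ys))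
at-split {xs = _ ∷ xs} here      = [] , xs , refl , refl
at-split {xs = v ∷ _}  (there p) with at-split p
... | ys , zs , refl , refl = v ∷ ys , zs , refl , refl

at-map⁺ : (f : A → B) {u : A} {xs : List A} → xs at i is u → map f xs at i is f u
at-map⁺ f here      = here
at-map⁺ f (there p) = there (at-map⁺ f p)

at-map⁻ : (f : A → B) {v : B} (xs : List A) → map f xs at i is v →
          ∃[ u ] (xs at i is u × v ≡ f u)
at-map⁻ f (u ∷ _)  here      = u , here , refl
at-map⁻ f (_ ∷ xs) (there p) = let u , q , eq = at-map⁻ f xs p in u , there q , eq

at-∷ʳ⁻ : {u v : A} (xs : List A) → (xs ∷ʳ v) at i is u →
         xs at i is u ⊎ (i ≡ suc (length xs) × u ≡ v)
at-∷ʳ⁻ []       here      = inj₂ (refl , refl)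
at-∷ʳ⁻ (_ ∷ xs) here      = inj₁ here
at-∷ʳ⁻ (_ ∷ xs) (there p) with at-∷ʳ⁻ xs p
... | inj₁ q           = inj₁ (there q)
... | inj₂ (refl , eq) = inj₂ (refl , eq)

at-middle⁻ : {u v : A} (xs : List A) {ys : List A} → (xs ++ v ∷ ys) at i is u →
             (i ≡ suc (length xs) × u ≡ v) ⊎ (∀ w → (xs ++ w ∷ ys) at i is u)
at-middle⁻ []       here      = inj₁ (refl , refl)
at-middle⁻ []       (there p) = inj₂ λ _ → there p
at-middle⁻ (_ ∷ xs) here      = inj₂ λ _ → here
at-middle⁻ (_ ∷ xs) (there p) with at-middle⁻ xs p
... | inj₁ (refl , eq) = inj₁ (refl , eq)
... | inj₂ q           = inj₂ (there ∘ q)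

at-prefix : {u : A} (xs : List A) {ys : List A} → (xs ++ ys) at i is u → i ≤ length xs →
            xs at i is u
at-prefix []       p         i≤0       = contradiction (≤-trans (at-positive p) i≤0) λ ()
at-prefix (_ ∷ xs) here      _         = here
at-prefix (_ ∷ xs) (there p) (s≤s i≤) = there (at-prefix xs p i≤)

all-at : {P : A → Set} (xs : List A) → (∀ {i u} → xs at i is u → P u) → All P xs
all-at []       f = []
all-at (_ ∷ xs) f = f here ∷ all-at xs (f ∘ there)

at-all : {P : A → Set} {u : A} {xs : List A} → All P xs → xs at i is u → P u
at-all ps p = All.lookup ps (at⇒∈ p)

-- Boxes of fillings

-- The tableau conditions that mention neither `n` nor the strips. They survive placing a new
-- largest entry, deleting the entries above a bound, and removing the bottom row, so both
-- directions can carry them through an induction.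
record Ordered (Q : Filling) : Set where
  field
    rows        : ∀ {c d r x y} → Q [ c , r ]= x → Q [ d , r ]= y → c < d → x < y
    firstColumn : ∀ {r s x y} → Q [ 1 , r ]= x → Q [ 1 , s ]= y → s < r → x < y
    triple      : ∀ {c r s x y} → Q [ c , r ]= x → Q [ c , s ]= y → s < r → y < x →
                  ∃[ z ] (Q [ suc c , s ]= z × z < x)

-- The box form of standardness. It is easier to transfer to a filling with entries deleted than a
-- permutation of the concatenated rows would be.
record Bijective (n : ℕ) (Q : Filling) : Set where
  field
    range  : Q [ c , r ]= x → 0 < x × x ≤ n
    exists : 0 < x → x ≤ n → ∃[ c ] ∃[ r ] Q [ c , r ]= x
    unique : Q [ c , r ]= x → Q [ d , s ]= x → c ≡ d × r ≡ s

  column-unique : InColumn Q x c → InColumn Q x d → c ≡ d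
  column-unique (_ , p) (_ , q) = proj₁ (unique p q)

box⇒∈ : Q [ c , r ]= x → x ∈ concat Q
box⇒∈ (_ , here , p)                = ∈-++⁺ˡ (at⇒∈ p)
box⇒∈ {Q = ρ ∷ _} (_ , there q , p) = ∈-++⁺ʳ ρ (box⇒∈ (_ , q , p))

∈⇒box : ∀ Q → x ∈ concat Q → ∃[ c ] ∃[ r ] Q [ c , r ]= x
∈⇒box (ρ ∷ Q) x∈ with ∈-++⁻ ρ x∈
... | inj₁ x∈ρ = let c , p = ∈⇒at x∈ρ in c , 1 , _ , here , p
... | inj₂ x∈Q = let c , r , _ , q , p = ∈⇒box Q x∈Q in c , suc r , _ , there q , p

unique-++ : (xs : List A) {ys : List A} → Unique (xs ++ ys) →
            Unique xs × Unique ys × (∀ {u} → u ∈ xs → u ∈ ys → ⊥)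
unique-++ []       u        = [] , u , λ ()
unique-++ (x ∷ xs) {ys} (x≢ ∷ u) =
  let u₁ , u₂ , disjoint = unique-++ xs u in
  All.tabulate (λ z∈ → All.lookup x≢ (∈-++⁺ˡ z∈)) ∷ u₁ , u₂ ,
  λ { (here refl) z∈ → contradiction refl (All.lookup x≢ (∈-++⁺ʳ xs z∈))
    ; (there z∈)     → disjoint z∈ }

unique-at : {u : A} {xs : List A} → Unique xs → xs at i is u → xs at j is u → i ≡ j
unique-at _        here      here      = refl
unique-at (u≢ ∷ _) here      (there q) = contradiction refl (at-all u≢ q)
unique-at (u≢ ∷ _) (there p) here      = contradiction refl (at-all u≢ p)
unique-at (_ ∷ us) (there p) (there q) = cong suc (unique-at us p q)

unique-box : ∀ Q → Unique (concat Q) → Q [ c , r ]= x → Q [ d , s ]= x → c ≡ d × r ≡ s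
unique-box (ρ ∷ Q) u b₁ b₂ with unique-++ ρ u
unique-box (ρ ∷ Q) u (_ , here , p) (_ , here , q) | uρ , _ , _ = unique-at uρ p q , refl
unique-box (ρ ∷ Q) u (_ , here , p) (_ , there s , q) | _ , _ , disjoint =
  ⊥-elim (disjoint (at⇒∈ p) (box⇒∈ (_ , s , q)))
unique-box (ρ ∷ Q) u (_ , there r , p) (_ , here , q) | _ , _ , disjoint =
  ⊥-elim (disjoint (at⇒∈ q) (box⇒∈ (_ , r , p)))
unique-box (ρ ∷ Q) u (_ , there r , p) (_ , there s , q) | _ , uQ , _ =
  let c≡d , r≡s = unique-box Q uQ (_ , r , p) (_ , s , q) in c≡d , cong suc r≡s

standard⇒range : concat Q ↭ [1⋯ n ] → Q [ c , r ]= x → 0 < x × x ≤ n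
standard⇒range {n = n} st b with ∈-applyUpTo⁻ suc {n = n} (∈-resp-↭ st (box⇒∈ b))
... | _ , i<n , refl = s≤s z≤n , i<n

standard⇒bijective : concat Q ↭ [1⋯ n ] → Bijective n Q
standard⇒bijective {Q} {n} st = record
  { range  = standard⇒range st
  ; exists = λ { (s≤s _) x≤n → ∈⇒box Q (∈-resp-↭ (↭-sym st) (∈-applyUpTo⁺ suc x≤n)) }
  ; unique = unique-box Q (Unique-resp-↭ (setoid ℕ) (↭⇒↭ₛ (↭-sym st))
                 (applyUpTo⁺₁ suc n λ i<j _ eq → <⇒≢ i<j (suc-injective eq)))
  }

bijective⇒max : Bijective m Q → 0 < m → max 0 (concat Q) ≡ m
bijective⇒max {m} {Q} bij 0<m =
  let _ , _ , b = exists 0<m ≤-refl in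
  max≈v⁺ (box⇒∈ b)
    (All.tabulate λ x∈ → let _ , _ , b′ = ∈⇒box Q x∈ in proj₂ (range b′)) z≤n
  where open Bijective bij

-- Placing an entry

place-⊆ : Place x c Q d Q′ → Q [ e , r ]= y → Q′ [ e , r ]= y
place-⊆ (place below row above _ _) (ρ , q , p) with at-middle⁻ below q
... | inj₁ (refl , refl) = _ , at-middle below , at-++ˡ p
... | inj₂ q′            = ρ , q′ _ , p

place-new : Place x c Q d Q′ → InColumn Q′ x d
place-new (place below row above _ _) = _ , _ , at-middle below , at-middle row

place-inv : ∀ below {above} → (below ++ (row ∷ʳ x) ∷ above) [ d , r ]= y →
            (below ++ row ∷ above) [ d , r ]= y ⊎
            (d ≡ suc (length row) × r ≡ suc (length below) × y ≡ x)
place-inv {row} below (ρ , q , p) with at-middle⁻ below q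
... | inj₂ q′ = inj₁ (ρ , q′ row , p)
... | inj₁ (refl , refl) with at-∷ʳ⁻ row p
...   | inj₁ p′            = inj₁ (row , at-middle below , p′)
...   | inj₂ (refl , refl) = inj₂ (refl , refl , refl)

place-ordered : Place (suc m) c Q d Q′ → 0 < c → (∀ {e r y} → Q [ e , r ]= y → y ≤ m) →
                Ordered Q → Ordered Q′
place-ordered {m} {Q = Q} {Q′ = Q′} (place below row above c<d free) 0<c bound ord = record
  { rows = rows′ ; firstColumn = firstColumn′ ; triple = triple′ }
  where
  open Ordered ord

  -- Since `0 < c`, the new box lies in column 2 or beyond, so the first column is unchanged.
  row-nonempty : 0 < length row
  row-nonempty = ≤-trans 0<c (s≤s⁻¹ c<d)

  row-end : ∀ {e y} → Q [ e , suc (length below) ]= y → e ≤ length row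
  row-end (ρ , q , p) with at-functional q (at-middle below)
  ... | refl = at-≤-length p

  rows′ : ∀ {c d r x y} → Q′ [ c , r ]= x → Q′ [ d , r ]= y → c < d → x < y
  rows′ bx by c<d with place-inv below bx | place-inv below by
  ... | inj₁ bx′ | inj₁ by′ = rows bx′ by′ c<d
  ... | inj₁ bx′ | inj₂ (_ , _ , refl) = s≤s (bound bx′)
  ... | inj₂ (refl , refl , _) | inj₁ by′ = 
    contradiction (row-end by′) (<⇒≱ (<-trans (n<1+n _) c<d))
  ... | inj₂ (refl , _ , _) | inj₂ (refl , _ , _) = contradiction c<d (<-irrefl refl)

  firstColumn′ : ∀ {r s x y} → Q′ [ 1 , r ]= x → Q′ [ 1 , s ]= y → s < r → x < y
  firstColumn′ bx by s<r with place-inv below bx | place-inv below by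
  ... | inj₁ bx′ | inj₁ by′ = firstColumn bx′ by′ s<r
  ... | inj₂ (eq , _) | _ = contradiction (suc-injective eq) (<⇒≢ row-nonempty)
  ... | inj₁ _ | inj₂ (eq , _) = contradiction (suc-injective eq) (<⇒≢ row-nonempty)

  triple′ : ∀ {c r s x y} → Q′ [ c , r ]= x → Q′ [ c , s ]= y → s < r → y < x →
            ∃[ z ] (Q′ [ suc c , s ]= z × z < x)
  triple′ bx by s<r y<x with place-inv below bx | place-inv below by
  ... | inj₁ bx′ | inj₁ by′ =
    let z , bz , z<x = triple bx′ by′ s<r y<x
    in z , place-⊆ (place below row above c<d free) bz , z<x
  ... | inj₁ bx′ | inj₂ (_ , _ , refl) = 
    contradiction (bound bx′) (<⇒≱ (<-trans (n<1+n _) y<x))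
  ... | inj₂ (_ , refl , _) | inj₂ (_ , refl , _) = contradiction s<r (<-irrefl refl)
  -- The lower row `ρ` reaches the column of the new entry and, by rule (3), does not end there. Its
  -- next box holds an old entry, which is smaller than the new one.
  ... | inj₂ (refl , refl , refl) | inj₁ (ρ , q , p) =
    let q′ = at-prefix below q (s≤s⁻¹ s<r)
        z , bz = at-exists ρ (s≤s z≤n) (≤∧≢⇒< (at-≤-length p) (at-all free q′ ∘ sym))
    in z , place-⊆ (place below row above c<d free) (ρ , q , bz) , s≤s (bound (ρ , q , bz))

-- The new box is at the bottom of the first column and holds the largest entry, so it can never be
-- the smaller entry in the triple condition. Only one box is added here: the second entry of the
-- row is treated later as an ordinary placement.
new-row-ordered : (∀ {e r y} → Q [ e , r ]= y → y ≤ m) → Ordered Q → Ordered ((suc m ∷ []) ∷ Q)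
new-row-ordered {Q} {m} bound ord = record
  { rows = rows′ ; firstColumn = firstColumn′ ; triple = triple′ }
  where
  open Ordered ord

  Q⁺ : Filling
  Q⁺ = (suc m ∷ []) ∷ Q

  rows′ : ∀ {c d r x y} → Q⁺ [ c , r ]= x → Q⁺ [ d , r ]= y → c < d → x < y
  rows′ (_ , here , here)      (_ , here , here)      c<d = contradiction c<d (<-irrefl refl)
  rows′ (_ , here , _)         (_ , there q , _)      _   = contradiction (at-positive q) λ ()
  rows′ (_ , there q , _)      (_ , here , _)         _   = contradiction (at-positive q) λ ()
  rows′ (_ , there q , p)      (_ , there q′ , p′)    c<d = rows (_ , q , p) (_ , q′ , p′) c<d

  firstColumn′ : ∀ {r s x y} → Q⁺ [ 1 , r ]= x → Q⁺ [ 1 , s ]= y → s < r → x < y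
  firstColumn′ (_ , here , _)    (_ , q , _)        (s≤s s≤0) =
    contradiction (≤-trans (at-positive q) s≤0) λ ()
  firstColumn′ (_ , there q , p) (_ , here , here)  _         = s≤s (bound (_ , q , p))
  firstColumn′ (_ , there q , p) (_ , here , there ())
  firstColumn′ (_ , there q , p) (_ , there q′ , p′) (s≤s s<r) =
    firstColumn (_ , q , p) (_ , q′ , p′) s<r

  triple′ : ∀ {c r s x y} → Q⁺ [ c , r ]= x → Q⁺ [ c , s ]= y → s < r → y < x →
            ∃[ z ] (Q⁺ [ suc c , s ]= z × z < x)
  triple′ (_ , here , _)    (_ , q , _)         (s≤s s≤0) _ =
    contradiction (≤-trans (at-positive q) s≤0) λ ()
  triple′ (_ , there q , p) (_ , here , here)   _ m<x =
    contradiction (bound (_ , q , p)) (<⇒≱ (<-trans (n<1+n _) m<x))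
  triple′ (_ , there q , p) (_ , there q′ , p′) (s≤s s<r) y<x =
    let z , (_ , q″ , p″) , z<x = triple (_ , q , p) (_ , q′ , p′) s<r y<x
    in z , (_ , there q″ , p″) , z<x

place-concat : Place x c Q d Q′ → concat Q′ ↭ x ∷ concat Q
place-concat {x} (place [] row above _ _) =
  ↭-trans (↭-reflexive (++-assoc row (x ∷ []) (concat above))) (shift x row (concat above))
place-concat {x} (place (ρ ∷ below) row above c<d (_ ∷ free)) =
  ↭-trans (++⁺ˡ ρ (place-concat (place below row above c<d free)))
          (shift x ρ (concat (below ++ row ∷ above)))

suc-standard : ∀ {xs} → xs ↭ [1⋯ m ] → suc m ∷ xs ↭ [1⋯ suc m ]
suc-standard {m} st =
  ↭-trans (prep (suc m) st)
    (↭-trans (∷↭∷ʳ (suc m) [1⋯ m ]) (↭-reflexive (applyUpTo-∷ʳ suc m)))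

-- A run in inductive form, with a column bound `c` carried along. It follows the recursion of
-- `PlaceMany`, where `c` is the column of the last entry placed; the bound `0` imposes nothing.
data Rising (Q : Filling) : ℕ → ℕ → ℕ → Set where
  []  : Rising Q c x 0
  _∷_ : InColumn Q x d × c < d → Rising Q d (suc x) l → Rising Q c x (suc l)

placeMany-⊆ : PlaceMany x l c Q Q′ → Q [ e , r ]= y → Q′ [ e , r ]= y
placeMany-⊆ done        b = b
placeMany-⊆ (next pl pm) b = placeMany-⊆ pm (place-⊆ pl b)

place-< : Place x c Q d Q′ → c < d
place-< (place _ _ _ c<d _) = c<d

placeMany-rising : PlaceMany x l c Q Q′ → Rising Q′ c x l
placeMany-rising done        = []
placeMany-rising (next pl pm) =
  (let r , b = place-new pl in (r , placeMany-⊆ pm b) , place-< pl) ∷ placeMany-rising pm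

placeMany-tableau : PlaceMany (suc m) l c Q Q′ → 0 < c → Ordered Q → concat Q ↭ [1⋯ m ] →
                    Ordered Q′ × concat Q′ ↭ [1⋯ l + m ]
placeMany-tableau done _ ord st = ord , st
placeMany-tableau {m} {suc l} (next {Q″ = Q″} pl pm) 0<c ord st =
  let ord′ , st′ = placeMany-tableau pm (<-trans 0<c (place-< pl))
                     (place-ordered pl 0<c (proj₂ ∘ standard⇒range st) ord)
                     (↭-trans (place-concat pl) (suc-standard st))
  in ord′ , subst (λ k → concat Q″ ↭ [1⋯ k ]) (+-suc l m) st′

-- Covers every round and also the start of the procedure, which is the case of the empty filling
-- with `m` equal to 0.
new-row-placed : Ordered Q → concat Q ↭ [1⋯ m ] → PlaceMany (2 + m) j 1 ((suc m ∷ []) ∷ Q) Q′ →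
                 Ordered Q′ × concat Q′ ↭ [1⋯ suc j + m ] ×
                 InColumn Q′ (suc m) 1 × Rising Q′ 0 (suc m) (suc j)
new-row-placed {Q} {m} {j} {Q′} ord st pm =
  let ord′ , st′ = placeMany-tableau pm (s≤s z≤n)
                     (new-row-ordered (proj₂ ∘ standard⇒range st) ord) (suc-standard st)
      first      = 1 , placeMany-⊆ pm (_ , here , here)
  in ord′ , subst (λ k → concat Q′ ↭ [1⋯ k ]) (+-suc j m) st′ ,
     first , (first , s≤s z≤n) ∷ placeMany-rising pm

-- Peak shapes

-- The peak condition together with positive parts and at least one row, in a form suited to
-- recursion on the rows. The exempt last part is the top row, at the end of the list.
data Wide : Filling → Set where
  top : 0 < length row → Wide (row ∷ [])
  _∷_ : 1 < length row → Wide Q → Wide (row ∷ Q)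

wide-positive : Wide Q → All (0 <_) (shape Q)
wide-positive (top 0<)  = 0< ∷ []
wide-positive (1< ∷ w) = <-trans (s≤s z≤n) 1< ∷ wide-positive w

wide⇒peak : Wide Q → IsPeak (shape Q)
wide⇒peak (top _)  zero    (s≤s ())
wide⇒peak (1< ∷ _) zero    _        = 1<
wide⇒peak (_ ∷ w)  (suc i) (s≤s i<) = wide⇒peak w i i<

peak-tail : IsPeak (p ∷ α) → IsPeak α
peak-tail peak i i< = peak (suc i) (s≤s i<)

peak⇒wide : 0 < length Q → All (0 <_) (shape Q) → IsPeak (shape Q) → Wide Q
peak⇒wide {_ ∷ []}    _ (0< ∷ []) _    = top 0<
peak⇒wide {_ ∷ _ ∷ _} _ (_ ∷ 0<s) peak =
  peak zero (s≤s (s≤s z≤n)) ∷ peak⇒wide (s≤s z≤n) 0<s (peak-tail peak)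

place-wide : Place x c Q d Q′ → Wide Q → Wide Q′
place-wide {x} (place [] row _ _ _) (top 0<) =
  top (subst (0 <_) (sym (length-++ row)) (≤-trans 0< (m≤m+n _ 1)))
place-wide (place [] row _ _ _) (1< ∷ w) =
  subst (1 <_) (sym (length-++ row)) (≤-trans 1< (m≤m+n _ 1)) ∷ w
place-wide (place (_ ∷ []) row above c<d (_ ∷ free)) (1< ∷ w) =
  1< ∷ place-wide (place [] row above c<d free) w
place-wide (place (_ ∷ below@(_ ∷ _)) row above c<d (_ ∷ free)) (1< ∷ w) =
  1< ∷ place-wide (place below row above c<d free) w

placeMany-wide : PlaceMany x l c Q Q′ → Wide Q → Wide Q′
placeMany-wide done         w = w
placeMany-wide (next pl pm) w = placeMany-wide pm (place-wide pl w)

-- Row strips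

-- Reversing α makes the row strip of a part start just after the sum of the later parts.
data Parts (P : ℕ → ℕ → Set) : List ℕ → Set where
  []  : Parts P []
  _∷_ : P (sum α) p → Parts P α → Parts P (p ∷ α)

-- The inequality handed to the map says that the strip stays among the entries up to `sum α`; this
-- is what allows strips to be transported to a filling that retains only those entries.
parts-map : ∀ {P R : ℕ → ℕ → Set} → All (0 <_) α →
            (∀ {s p} → 0 < p → p + s ≤ sum α → P s p → R s p) → Parts P α → Parts R α
parts-map _          f []                  = []
parts-map (0<p ∷ 0<) f (_∷_ {p = p} h hs) =
  f 0<p ≤-refl h ∷ parts-map 0< (λ 0<q ≤s → f 0<q (≤-trans ≤s (m≤n+m _ p))) hs

Prefixes : (ℕ → ℕ → Set) → List ℕ → Set
Prefixes P γ = ∀ (i : Fin (length γ)) → P (sum (take (toℕ i) γ)) (lookup γ i)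

prefixes-∷ʳ⁺ : ∀ {P : ℕ → ℕ → Set} γ → Prefixes P γ → P (sum γ) p → Prefixes P (γ ∷ʳ p)
prefixes-∷ʳ⁺         []      hs h zero    = h
prefixes-∷ʳ⁺         (q ∷ γ) hs h zero    = hs zero
-- Every prefix sum past the head contains `q`, so the induction runs on the predicate shifted by
-- `q`.
prefixes-∷ʳ⁺ {P = P} (q ∷ γ) hs h (suc i) = prefixes-∷ʳ⁺ {P = P ∘ (q +_)} γ (hs ∘ suc) h i

prefixes-∷ʳ⁻ : ∀ {P : ℕ → ℕ → Set} γ → Prefixes P (γ ∷ʳ p) → Prefixes P γ × P (sum γ) p
prefixes-∷ʳ⁻         []      hs = (λ ()) , hs zero
prefixes-∷ʳ⁻ {P = P} (q ∷ γ) hs =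
  let hs′ , h = prefixes-∷ʳ⁻ {P = P ∘ (q +_)} γ (hs ∘ suc)
  in (λ { zero → hs zero ; (suc i) → hs′ i }) , h

sum-reverse : ∀ α → sum (reverse α) ≡ sum α
sum-reverse α = sum-↭ (↭-reverse α)

parts⇒prefixes : ∀ {P : ℕ → ℕ → Set} → Parts P α → Prefixes P (reverse α)
parts⇒prefixes []                              ()
parts⇒prefixes {α = p ∷ α} {P = P} (h ∷ hs) =
  subst (Prefixes P) (sym (unfold-reverse p α))
    (prefixes-∷ʳ⁺ {P = P} (reverse α) (parts⇒prefixes hs)
      (subst (λ s → P s p) (sym (sum-reverse α)) h))

prefixes⇒parts : ∀ {P : ℕ → ℕ → Set} α → Prefixes P (reverse α) → Parts P α
prefixes⇒parts         []      hs = []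
prefixes⇒parts {P = P} (p ∷ α) hs =
  let hs′ , h = prefixes-∷ʳ⁻ {P = P} (reverse α) (subst (Prefixes P) (unfold-reverse p α) hs)
  in subst (λ s → P s p) (sum-reverse α) h ∷ prefixes⇒parts α hs′

-- A row strip with maximality replaced by a start in column 1. For strips that together cover all
-- entries this replacement loses nothing, and it is much easier to preserve when the filling
-- changes.
IsStart : Filling → ℕ → ℕ → Set
IsStart Q s p = InColumn Q (suc s) 1 × Rising Q 0 (suc s) p

rising-⊆ : (∀ {y e} → y < x + l → InColumn Q y e → InColumn Q′ y e) →
           Rising Q c x l → Rising Q′ c x l
rising-⊆ f []                           = []
rising-⊆ {x} {suc l} f ((in-d , c<d) ∷ rs) =
  (f (m<m+n x (s≤s z≤n)) in-d , c<d) ∷ rising-⊆ (λ {y} → f ∘ subst (y <_) (sym (+-suc x l))) rs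

rising-column : Rising Q c x l → x ≤ y → y < x + l → ∃[ d ] (InColumn Q y d × c < d)
rising-column {x = x} {y = y} [] x≤y y<x =
  contradiction (subst (y <_) (+-identityʳ x) y<x) (≤⇒≯ x≤y)
rising-column {x = x} {suc l} {y} (_∷_ {d = d} (in-d , c<d) rs) x≤y y< with m≤n⇒m<n∨m≡n x≤y
... | inj₂ refl = d , in-d , c<d
... | inj₁ x<y  =
  let e , in-e , d<e = rising-column rs x<y (subst (y <_) (+-suc x l) y<)
  in e , in-e , <-trans c<d d<e

-- The invariant of the generating procedure

record Invariant (α : List ℕ) (Q : Filling) : Set where
  field
    ordered  : Ordered Q
    standard : concat Q ↭ [1⋯ sum α ]
    wide     : Wide Q
    starts   : Parts (IsStart Q) α

-- Presents the initial row as a result of successive placements, so that `new-row-placed` applies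
-- to it.
[1⋯]-placed : c ≤ k → PlaceMany (suc k) l c ([1⋯ k ] ∷ []) ([1⋯ l + k ] ∷ [])
[1⋯]-placed {l = zero}          _   = done
[1⋯]-placed {c} {k} {suc l} c≤k =
  next (subst (λ ρ → Place (suc k) _ ([1⋯ k ] ∷ []) (suc (length [1⋯ k ])) (ρ ∷ []))
              (applyUpTo-∷ʳ suc k)
              (place [] [1⋯ k ] [] (s≤s (subst (c ≤_) (sym len) c≤k)) []))
       (subst (λ j → PlaceMany (2 + k) l (suc (length [1⋯ k ])) ([1⋯ suc k ] ∷ []) ([1⋯ j ] ∷ []))
              (+-suc l k)
              ([1⋯]-placed (s≤s (≤-reflexive len))))
  where
  len : length [1⋯ k ] ≡ k
  len = length-applyUpTo suc k

generated⇒invariant : All (0 <_) α → Generated α Q → Invariant α Q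
generated⇒invariant (s≤s {n = j} _ ∷ []) start =
  let ord , st , first = new-row-placed {Q = []} {m = 0}
        (record
          { rows        = λ { (_ , () , _) }
          ; firstColumn = λ { (_ , () , _) }
          ; triple      = λ { (_ , () , _) }
          })
        ↭-refl
        (subst (λ k → PlaceMany 2 j 1 ([1⋯ 1 ] ∷ []) ([1⋯ k ] ∷ [])) (+-comm j 1)
               ([1⋯]-placed {l = j} ≤-refl))
  in record { ordered = ord ; standard = st ; wide = top (s≤s z≤n) ; starts = first ∷ [] }
generated⇒invariant {α = _ ∷ α@(_ ∷ δ)} {Q = Q′} (_ ∷ 0<α@(0<q ∷ _))
                    (round {Q = Q} gen (step {l} pm)) =
  let ord , st , first = new-row-placed ordered standard pm⁺
  in record
    { ordered  = ord
    ; standard = st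
    ; wide     = placeMany-wide pm (s≤s (s≤s z≤n) ∷ wide)
    ; starts   = first ∷ parts-map 0<α (λ _ _ (f , rs) → keep f , rising-⊆ (λ _ → keep) rs) starts
    }
  where
  open Invariant (generated⇒invariant 0<α gen)

  max≡ : max 0 (concat Q) ≡ sum α
  max≡ = bijective⇒max {Q = Q} (standard⇒bijective standard) (≤-trans 0<q (m≤m+n _ (sum δ)))

  -- The second entry of the new row is read as a placement after the one-box row: it moves from
  -- column 1 to column 2, and no row lies below to violate rule (3).
  pm⁺ : PlaceMany (2 + sum α) (suc l) 1 ((suc (sum α) ∷ []) ∷ Q) Q′
  pm⁺ = next (place [] (_ ∷ []) Q (s≤s (s≤s z≤n)) [])
             (subst (λ m → PlaceMany (3 + m) l 2 ((1 + m ∷ 2 + m ∷ []) ∷ Q) Q′) max≡ pm)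

  keep : InColumn Q y e → InColumn Q′ y e
  keep (r , ρ , q , p) = suc r , placeMany-⊆ pm (ρ , there q , p)

-- Boundaries between row strips

Bar : Filling → ℕ → Set
Bar Q a = ∀ {b l} → IsRun Q b l → b < a → b + l ≤ a

run-step : IsRun Q b l → b ≤ y → suc y < b + l →
           ∃[ c ] ∃[ d ] (InColumn Q y c × InColumn Q (suc y) d × c < d)
run-step {Q} {b} {l} {y} run b≤y y< =
  let i          = y ∸ b
      b+i≡y      = m+[n∸m]≡n b≤y
      b+1+i≡     = trans (+-suc b i) (cong suc b+i≡y)
      c , d , ic , id , c<d =
        rightward i (+-cancelˡ-< b (suc i) l (subst (_< b + l) (sym b+1+i≡) y<))
  in c , d , subst (λ z → InColumn Q z c) b+i≡y ic , subst (λ z → InColumn Q z d) b+1+i≡ id , c<d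
  where open IsRun run

rising⇒run : Rising Q c a l → 0 < l → IsRun Q a l
rising⇒run {Q} {c} {a} {l} rs 0<l = record
  { nonempty  = 0<l
  ; entries   = λ i i<l →
      let d , in-d , _ = rising-column rs (m≤m+n a i) (+-monoʳ-< a i<l) in d , in-d
  ; rightward = steps rs
  }
  where
  steps : ∀ {c a l} → Rising Q c a l → ∀ i → suc i < l →
          ∃[ c ] ∃[ d ] (InColumn Q (a + i) c × InColumn Q (a + suc i) d × c < d)
  steps {a = a} (_∷_ {d = c} (in-c , _) (_∷_ {d = d} (in-d , c<d) _)) zero _ =
    c , d , subst (λ z → InColumn Q z c) (sym (+-identityʳ a)) in-c ,
    subst (λ z → InColumn Q z d) (sym (+-comm a 1)) in-d , c<d
  steps {a = a} (_ ∷ rs) (suc i) (s≤s i<) =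
    let c , d , in-c , in-d , c<d = steps rs i i<
    in c , d , subst (λ z → InColumn Q z c) (sym (+-suc a i)) in-c ,
       subst (λ z → InColumn Q z d) (sym (+-suc a (suc i))) in-d , c<d

run-tail : IsRun Q a (2 + l) → IsRun Q (suc a) (suc l)
run-tail {Q} {a} run = record
  { nonempty  = s≤s z≤n
  ; entries   = λ i i< →
      subst (λ z → ∃[ d ] InColumn Q z d) (+-suc a i) (entries (suc i) (s≤s i<))
  ; rightward = λ i i< →
      let c , d , in-c , in-d , c<d = rightward (suc i) (s≤s i<)
      in c , d , subst (λ z → InColumn Q z c) (+-suc a i) in-c ,
         subst (λ z → InColumn Q z d) (+-suc a (suc i)) in-d , c<d
  }
  where open IsRun run

run-first : IsRun Q a l → ∃[ c ] InColumn Q a c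
run-first {Q} {a} run =
  subst (λ z → ∃[ c ] InColumn Q z c) (+-identityʳ a) (entries 0 nonempty)
  where open IsRun run

module _ (bij : Bijective n Q) where
  open Bijective bij

  run⇒rising : ∀ l → IsRun Q a l → (∀ {d} → InColumn Q a d → c < d) → Rising Q c a l
  run⇒rising         zero          _   _   = []
  run⇒rising         (suc zero)    run c<d = let _ , in-d = run-first run in (in-d , c<d in-d) ∷ []
  run⇒rising {a = a} (suc (suc l)) run c<d =
    let d , e , in-d , in-e , d<e =
          run-step run ≤-refl (subst (_≤ a + (2 + l)) (+-comm a 2) (+-monoʳ-≤ a (s≤s (s≤s z≤n))))
    in (in-d , c<d in-d) ∷
       run⇒rising (suc l) (run-tail run) (λ in-e′ → subst (d <_) (column-unique in-e in-e′) d<e)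

  -- A run crossing this boundary would contain both `s` and `suc s`, placing `suc s` strictly to
  -- the right of some column, hence not in column 1.
  bar-start : InColumn Q (suc s) 1 → Bar Q (suc s)
  bar-start {s} first {b} {l} run (s≤s b≤s) with suc s <? b + l
  ... | no  ≮ = ≮⇒≥ ≮
  ... | yes < with run-step run b≤s <
  ...   | _ , _ , (_ , _ , _ , p) , in-d , c<d with column-unique in-d first
  ...     | refl = contradiction (at-positive p) (<⇒≱ c<d)

  -- A run crossing this boundary would contain `suc n`, which is not an entry.
  bar-end : Bar Q (suc n)
  bar-end {b} {l} run (s≤s b≤n) with suc n <? b + l
  ... | no  ≮ = ≮⇒≥ ≮
  ... | yes < with run-step run b≤n <
  ...   | _ , _ , _ , (_ , box) , _ = contradiction (proj₂ (range box)) (<-irrefl refl)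

  -- Each strip lies between two bars: one at its own first entry, by `bar-start`, and one just
  -- after its last. A run containing the strip can therefore extend it on neither side. The parts
  -- are peeled off from the largest entries down, and the bar at the start of one strip closes the
  -- next one.
  starts⇒rowStrips : All (0 <_) α → Bar Q (suc (sum α)) → Parts (IsStart Q) α →
                     Parts (λ s p → IsRowStrip Q (suc s) p) α
  starts⇒rowStrips [] bar [] = []
  starts⇒rowStrips {p ∷ δ} (0<p ∷ 0<δ) bar ((first , rs) ∷ hs) =
    record { isRun = rising⇒run rs 0<p ; maximal = maximal } ∷
    starts⇒rowStrips 0<δ (bar-start first) hs
    where
    maximal : ∀ b l → IsRun Q b l → b ≤ suc (sum δ) → suc (sum δ) + p ≤ b + l →
              b ≡ suc (sum δ) × l ≡ p
    maximal b l run b≤ ≤b+l with m≤n⇒m<n∨m≡n b≤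
    ... | inj₁ b< = contradiction (≤-trans ≤b+l (bar-start first run b<)) (<⇒≱ (m<m+n _ 0<p))
    ... | inj₂ refl =
      refl , ≤-antisym
        (+-cancelˡ-≤ b l p (subst (b + l ≤_) (cong suc (+-comm p (sum δ)))
          (bar run (s≤s (m<n+m (sum δ) 0<p)))))
        (+-cancelˡ-≤ b p l ≤b+l)

  -- Find the part whose interval contains `a`. The bar after it confines the given strip to the run
  -- of that part, so maximality makes the two begin at the same entry, which is in column 1.
  rowStrip-start : Bar Q (suc (sum α)) → All (0 <_) α → Parts (IsStart Q) α → 0 < a → a ≤ sum α →
                   IsRowStrip Q a j → InColumn Q a 1
  rowStrip-start {[]} _ _ _ 0<a a≤0 _ = contradiction (≤-trans 0<a a≤0) λ ()
  rowStrip-start {p ∷ δ} {a} {j} bar (0<p ∷ 0<δ) ((first , rs) ∷ hs) 0<a a≤ strip with a ≤? sum δ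
  ... | yes a≤δ = rowStrip-start (bar-start first) 0<δ hs 0<a a≤δ strip
  ... | no  a≰δ = subst (λ z → InColumn Q z 1)
    (proj₁ (maximal (suc (sum δ)) p (rising⇒run rs 0<p) (≰⇒> a≰δ)
      (subst (a + j ≤_) (cong suc (+-comm p (sum δ))) (bar isRun (s≤s a≤)))))
    first
    where open IsRowStrip strip

  rowStrips⇒starts : (∀ {a j} → IsRowStrip Q a j → InColumn Q a 1) →
                     ∀ {s p} → IsRowStrip Q (suc s) p → IsStart Q s p
  rowStrips⇒starts strips strip =
    strips strip ,
    run⇒rising _ (IsRowStrip.isRun strip) λ { (_ , _ , _ , p) → at-positive p }

length-concat : ∀ Q → length (concat Q) ≡ sum (shape Q)
length-concat []      = refl
length-concat (ρ ∷ Q) = trans (length-++ ρ) (cong (length ρ +_) (length-concat Q))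

generated⇒DIRT : IsComposition n α → Generated α Q →
                 IsDIRT n Q × IsPeak (shape Q) × HasRowStripShape n Q (reverse α)
generated⇒DIRT {n} {α} {Q} record { positive = 0<α ; total = refl } gen =
  record
    { composition = record
      { positive = wide-positive wide
      ; total    = trans (sym (length-concat Q))
                         (trans (↭-length standard) (length-applyUpTo suc n))
      }
    ; standard    = standard
    ; rows        = rows
    ; strips      = λ strip →
        let _ , _ , box = run-first (IsRowStrip.isRun strip)
            0<a , a≤n = standard⇒range standard box
        in rowStrip-start bij (bar-end bij) 0<α starts 0<a a≤n strip
    ; firstColumn = firstColumn
    ; triple      = triple
    } ,
  wide⇒peak wide ,
  record
    { composition = record
      { positive = All-resp-↭ (↭-sym (↭-reverse α)) 0<α
      ; total    = sum-reverse α
      }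
    ; strip       = parts⇒prefixes (starts⇒rowStrips bij 0<α (bar-end bij) starts)
    }
  where
  open Invariant (generated⇒invariant 0<α gen)
  open Ordered ordered

  bij : Bijective n Q
  bij = standard⇒bijective standard

-- Restriction to small entries

-- In an ordered filling each row is cut down to an initial segment, so columns are preserved. Rows
-- that become empty stay in the list, so row numbers are preserved too.
restrict : ℕ → Filling → Filling
restrict m = map (filter (_≤? m))

AllPairs-at : {xs : List ℕ} →
              (∀ {c d x y} → xs at c is x → xs at d is y → c < d → x < y) → AllPairs _<_ xs
AllPairs-at {[]}     _   = []
AllPairs-at {_ ∷ xs} inc =
  all-at xs (λ q → inc here (there q) (s≤s (at-positive q))) ∷
  AllPairs-at (λ p q c<d → inc (there p) (there q) (s≤s c<d))

filter-at⁺ : ∀ {xs} → AllPairs _<_ xs → xs at i is x → x ≤ m → filter (_≤? m) xs at i is x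
filter-at⁺ {m = m} _ (here {xs = xs}) x≤m rewrite filter-accept (_≤? m) {xs = xs} x≤m = here
filter-at⁺ {m = m} (y< ∷ inc) (there {xs = xs} p) x≤m
  rewrite filter-accept (_≤? m) {xs = xs} (≤-trans (<⇒≤ (at-all y< p)) x≤m) =
  there (filter-at⁺ inc p x≤m)

filter-at⁻ : ∀ {xs} → AllPairs _<_ xs → filter (_≤? m) xs at i is x → xs at i is x × x ≤ m
filter-at⁻ {m} {i} {x} {y ∷ xs} (y< ∷ inc) p with ≤-<-connex y m
... | inj₁ y≤m = accepted (subst (_at i is x) (filter-accept (_≤? m) y≤m) p)
  where
  accepted : ∀ {i} → (y ∷ filter (_≤? m) xs) at i is x → (y ∷ xs) at i is x × x ≤ m
  accepted here      = here , y≤m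
  accepted (there q) = let q′ , x≤m = filter-at⁻ inc q in there q′ , x≤m
... | inj₂ m<y
  with () ← subst (_at i is x)
              (filter-none (_≤? m) (All.map <⇒≱ (m<y ∷ All.map (<-trans m<y) y<))) p

ordered-row : Ordered Q → Q at r is row → AllPairs _<_ row
ordered-row ord q = AllPairs-at λ p p′ → Ordered.rows ord (_ , q , p) (_ , q , p′)

restrict-box⁺ : Ordered Q → Q [ c , r ]= x → x ≤ m → restrict m Q [ c , r ]= x
restrict-box⁺ ord (_ , q , p) x≤m = _ , at-map⁺ _ q , filter-at⁺ (ordered-row ord q) p x≤m

restrict-box⁻ : Ordered Q → restrict m Q [ c , r ]= x → Q [ c , r ]= x × x ≤ m
restrict-box⁻ {Q} ord (_ , q , p) with at-map⁻ _ Q q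
... | ρ , q′ , refl = let p′ , x≤m = filter-at⁻ (ordered-row ord q′) p in (ρ , q′ , p′) , x≤m

-- The witness of the triple condition is smaller than the upper entry `x`, so it survives whenever
-- `x` does.
restrict-ordered : Ordered Q → Ordered (restrict m Q)
restrict-ordered ord = record
  { rows        = λ bx by → rows (old bx) (old by)
  ; firstColumn = λ bx by → firstColumn (old bx) (old by)
  ; triple      = λ bx by s<r y<x →
      let z , bz , z<x = triple (old bx) (old by) s<r y<x
      in z , restrict-box⁺ ord bz (≤-trans (<⇒≤ z<x) (proj₂ (restrict-box⁻ ord bx))) , z<x
  }
  where
  open Ordered ord
  old : ∀ {c r x} → restrict _ _ [ c , r ]= x → _ [ c , r ]= x
  old = proj₁ ∘ restrict-box⁻ ord

filter-suc : ∀ xs → All (_≢ suc m) xs → filter (_≤? suc m) xs ≡ filter (_≤? m) xs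
filter-suc         []       []         = refl
filter-suc {m = m} (x ∷ xs) (x≢ ∷ xs≢) with ≤-<-connex x m
... | inj₁ x≤m = begin
  filter (_≤? suc m) (x ∷ xs)  ≡⟨ filter-accept (_≤? suc m) (m≤n⇒m≤1+n x≤m) ⟩
  x ∷ filter (_≤? suc m) xs    ≡⟨ cong (x ∷_) (filter-suc xs xs≢) ⟩
  x ∷ filter (_≤? m) xs        ≡⟨ filter-accept (_≤? m) x≤m ⟨
  filter (_≤? m) (x ∷ xs)      ∎
  where open ≡-Reasoning
... | inj₂ m<x = begin
  filter (_≤? suc m) (x ∷ xs)  ≡⟨ filter-reject (_≤? suc m) (<⇒≱ (≤∧≢⇒< m<x (x≢ ∘ sym))) ⟩
  filter (_≤? suc m) xs        ≡⟨ filter-suc xs xs≢ ⟩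
  filter (_≤? m) xs            ≡⟨ filter-reject (_≤? m) (<⇒≱ m<x) ⟨
  filter (_≤? m) (x ∷ xs)      ∎
  where open ≡-Reasoning

restrict-suc : ∀ Q → (∀ {c r x} → Q [ c , r ]= x → x ≢ suc m) → restrict (suc m) Q ≡ restrict m Q
restrict-suc []      _    = refl
restrict-suc (ρ ∷ Q) x≢ =
  cong₂ _∷_ (filter-suc ρ (all-at ρ λ p → x≢ (_ , here , p)))
            (restrict-suc Q λ (_ , q , p) → x≢ (_ , there q , p))

restrict-all : ∀ Q → (∀ {c r x} → Q [ c , r ]= x → x ≤ m) → restrict m Q ≡ Q
restrict-all []      _ = refl
restrict-all (ρ ∷ Q) ≤m =
  cong₂ _∷_ (filter-all (_≤? _) (all-at ρ λ p → ≤m (_ , here , p)))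
            (restrict-all Q λ (_ , q , p) → ≤m (_ , there q , p))

-- In its row, `suc m` has only smaller entries to the left and larger ones to the right. Raising
-- the bound from `m` to `suc m` therefore appends it to the truncated row and changes no other row.
restrict-place : Ordered Q → Bijective n Q → Q [ d , r ]= suc m → c < d →
                 Place (suc m) c (restrict m Q) d (restrict (suc m) Q)
restrict-place {Q} {n} {d} {r} {m} {c} ord bij (row , q , p) c<d with at-split q | at-split p
... | below , above , refl , refl | ys , zs , refl , refl =
  subst₂ (λ X Y → Place (suc m) c X d Y) (sym before) (sym after)
    (place (restrict m below) ys (restrict m above) c<d free)
  where
  open Ordered ord
  open Bijective bij

  ys< : All (_< suc m) ys
  ys< = all-at ys λ p′ → rows (_ , q , at-++ˡ p′) (_ , q , p) (s≤s (at-≤-length p′))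

  zs> : All (suc m <_) zs
  zs> = all-at zs λ p′ → rows (_ , q , p) (_ , q , at-++ʳ ys (there p′))
          (subst (suc (length ys) <_) (sym (+-suc (length ys) _))
            (s≤s (m<m+n (length ys) (at-positive p′))))

  row-before : filter (_≤? m) row ≡ ys
  row-before = begin
    filter (_≤? m) (ys ++ suc m ∷ zs)
      ≡⟨ filter-++ (_≤? m) ys (suc m ∷ zs) ⟩
    filter (_≤? m) ys ++ filter (_≤? m) (suc m ∷ zs)
      ≡⟨ cong₂ _++_ (filter-all (_≤? m) (All.map s≤s⁻¹ ys<))
                    (filter-none (_≤? m) (<⇒≱ (n<1+n m) ∷ All.map (<⇒≱ ∘ <-trans (n<1+n m)) zs>)) ⟩
    ys ++ []
      ≡⟨ ++-identityʳ ys ⟩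
    ys ∎
    where open ≡-Reasoning

  row-after : filter (_≤? suc m) row ≡ ys ∷ʳ suc m
  row-after = begin
    filter (_≤? suc m) (ys ++ suc m ∷ zs)
      ≡⟨ filter-++ (_≤? suc m) ys (suc m ∷ zs) ⟩
    filter (_≤? suc m) ys ++ filter (_≤? suc m) (suc m ∷ zs)
      ≡⟨ cong₂ _++_ (filter-all (_≤? suc m) (All.map <⇒≤ ys<))
                    (trans (filter-accept (_≤? suc m) ≤-refl)
                           (cong (suc m ∷_) (filter-none (_≤? suc m) (All.map <⇒≱ zs>)))) ⟩
    ys ∷ʳ suc m ∎
    where open ≡-Reasoning

  before : restrict m Q ≡ restrict m below ++ ys ∷ restrict m above
  before = trans (map-++ _ below (row ∷ above))
                 (cong (λ ρ → restrict m below ++ ρ ∷ restrict m above) row-before)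

  below-≢ : ∀ {e s x} → below [ e , s ]= x → x ≢ suc m
  below-≢ (ρ , q′ , p′) refl =
    <⇒≢ (s≤s (at-≤-length q′)) (proj₂ (unique (ρ , at-++ˡ q′ , p′) (row , q , p)))

  above-≢ : ∀ {e s x} → above [ e , s ]= x → x ≢ suc m
  above-≢ {s = s} (ρ , q′ , p′) refl =
    <⇒≢ (m<m+n (suc (length below)) (at-positive q′))
        (trans (proj₂ (unique (row , q , p) (ρ , at-++ʳ below (there q′) , p′)))
               (+-suc (length below) s))

  after : restrict (suc m) Q ≡ restrict m below ++ (ys ∷ʳ suc m) ∷ restrict m above
  after = trans (map-++ _ below (row ∷ above))
                (cong₂ _++_ (restrict-suc below below-≢)
                  (cong₂ _∷_ row-after (restrict-suc above above-≢)))

  -- A row of length d below the chosen one would violate the triple condition at column d.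
  free : All (λ ρ → length ρ ≢ d) (restrict m below)
  free = all-at (restrict m below) λ q′ eq → full (at-map⁻ _ below q′) eq
    where
    full : ∀ {s ρ′} → ∃[ ρ ] (below at s is ρ × ρ′ ≡ filter (_≤? m) ρ) → length ρ′ ≢ d
    full (ρ , q′ , refl) eq =
      let inc          = ordered-row ord (at-++ˡ q′)
          y , p-y      = at-exists (filter (_≤? m) ρ) (s≤s z≤n) (≤-reflexive (sym eq))
          p-y′ , y≤m   = filter-at⁻ inc p-y
          z , (ρ″ , q″ , p-z) , z<x =
            triple (row , q , p) (ρ , at-++ˡ q′ , p-y′) (s≤s (at-≤-length q′)) (s≤s y≤m)
          p-z′         = subst (_at suc d is z) (at-functional q″ (at-++ˡ q′)) p-z
      in contradiction (at-≤-length (filter-at⁺ inc p-z′ (s≤s⁻¹ z<x))) (<⇒≱ (s≤s (≤-reflexive eq)))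

-- Recovering placements from a tableau

rising⇒placeMany : Ordered Q → Bijective n Q → Rising Q c (suc m) l →
                   PlaceMany (suc m) l c (restrict m Q) (restrict (l + m) Q)
rising⇒placeMany ord bij [] = done
rising⇒placeMany {Q} {m = m} {suc l} ord bij (_∷_ {d = d} ((_ , box) , c<d) rs) =
  next (restrict-place ord bij box c<d)
       (subst (λ k → PlaceMany (2 + m) l d (restrict (suc m) Q) (restrict k Q)) (+-suc l m)
              (rising⇒placeMany ord bij rs))

place-one-row : Place x c (row ∷ []) d Q → Q ≡ (row ∷ʳ x) ∷ []
place-one-row pl = go pl refl
  where
  go : Place x c Q d Q′ → Q ≡ row ∷ [] → Q′ ≡ (row ∷ʳ x) ∷ []
  go (place [] _ _ _ _)          refl = refl
  go (place (_ ∷ []) _ _ _ _)    ()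
  go (place (_ ∷ _ ∷ _) _ _ _ _) ()

placeMany-[1⋯] : PlaceMany (suc k) l c ([1⋯ k ] ∷ []) Q → Q ≡ [1⋯ l + k ] ∷ []
placeMany-[1⋯] done = refl
placeMany-[1⋯] {k} {suc l} {Q = Q} (next {d = d} pl pm) =
  trans (placeMany-[1⋯] (subst (λ X → PlaceMany (2 + k) l d X Q) extended pm))
        (cong (λ j → [1⋯ j ] ∷ []) (+-suc l k))
  where
  extended = trans (place-one-row pl) (cong (_∷ []) (applyUpTo-∷ʳ suc k))

ordered-tail : Ordered (row ∷ Q) → Ordered Q
ordered-tail ord = record
  { rows        = λ (_ , q , p) (_ , q′ , p′) → rows (_ , there q , p) (_ , there q′ , p′)
  ; firstColumn = λ (_ , q , p) (_ , q′ , p′) s<r →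
      firstColumn (_ , there q , p) (_ , there q′ , p′) (s≤s s<r)
  ; triple      = λ (_ , q , p) (_ , q′ , p′) s<r y<x →
      lower (at-positive q′) (triple (_ , there q , p) (_ , there q′ , p′) (s≤s s<r) y<x)
  }
  where
  open Ordered ord
  lower : ∀ {c s x row} {Q : Filling} → 0 < s →
          ∃[ z ] ((row ∷ Q) [ c , suc s ]= z × z < x) → ∃[ z ] (Q [ c , s ]= z × z < x)
  lower () (z , (_ , here , p) , z<x)
  lower _ (z , (_ , there q , p) , z<x) = z , (_ , q , p) , z<x

-- The peak condition depends on the first two columns only, and the hypothesis says that none of
-- their entries is deleted.
wide-restrict : Wide Q → (∀ {e r y} → Q [ e , r ]= y → e ≤ 2 → y ≤ m) → Ordered Q →
                Wide (restrict m Q)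
wide-restrict {Q = ρ ∷ []} (top 0<) small ord =
  let _ , p = at-exists ρ (s≤s z≤n) 0<
  in top (at-≤-length (filter-at⁺ (ordered-row ord here) p (small (ρ , here , p) (s≤s z≤n))))
wide-restrict {Q = ρ ∷ _} (1< ∷ w) small ord =
  let _ , p = at-exists ρ (s≤s z≤n) 1<
  in at-≤-length (filter-at⁺ (ordered-row ord here) p (small (ρ , here , p) ≤-refl)) ∷
     wide-restrict w (λ (_ , q , p) → small (_ , there q , p)) (ordered-tail ord)

-- The last strip and its removal

nonempty : Wide Q → ∃[ y ] ∃[ rest ] ∃[ Q₁ ] Q ≡ (y ∷ rest) ∷ Q₁
nonempty (top {row = y ∷ rest} _)          = y , rest , _ , refl
nonempty (_∷_ {row = y ∷ rest} {Q = Q} _ _) = y , rest , Q , refl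

rising-late : Bijective n Q → Rising Q c x l → Q [ e , r ]= y → x ≤ y → y < x + l → c < e
rising-late bij rs box x≤y y< =
  let d , in-d , c<d = rising-column rs x≤y y<
  in subst (_ <_) (Bijective.column-unique bij in-d (_ , box)) c<d

-- All entries after `suc m` belong to the last strip, hence lie to the right of the column of
-- `suc m`.
late-column : Bijective (suc j + m) Q → IsStart Q m (suc j) → Q [ e , r ]= y → suc m < y → 1 < e
late-column {j} {m} {y = y} bij (_ , (_ , 0<d) ∷ rs) box m<y =
  ≤-<-trans 0<d (rising-late bij rs box m<y
    (s≤s (subst (y ≤_) (cong suc (+-comm j m)) (proj₂ (Bijective.range bij box)))))

-- If `suc m` headed a higher row, the first entry of the bottom row would be larger, and
-- `late-column` would push it out of column 1.
bottom-first : Ordered ((y ∷ row) ∷ Q) → Bijective (suc j + m) ((y ∷ row) ∷ Q) →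
               IsStart ((y ∷ row) ∷ Q) m (suc j) → y ≡ suc m
bottom-first ord bij ((_ , _ , here , here) , _) = refl
bottom-first ord bij st@((_ , ρ , there q , p) , _) =
  contradiction
    (late-column bij st (_ , here , here)
      (Ordered.firstColumn ord (ρ , there q , p) (_ , here , here) (s≤s (at-positive q))))
    (<-irrefl refl)

bottom-large : Ordered ((suc m ∷ row) ∷ Q) → (suc m ∷ row) at c is x → m < x
bottom-large         _   here      = ≤-refl
bottom-large {m = m} ord (there p) =
  <-trans (n<1+n m)
    (Ordered.rows ord (_ , here , here) (_ , here , there p) (s≤s (at-positive p)))

-- The bottom row starts with 1, and a row above it would need a smaller positive first entry. With
-- one row only, replaying the strip leaves no choice.
single-strip⇒[1⋯] : Ordered Q → Bijective p Q → Wide Q → 0 < p → IsStart Q 0 p → Q ≡ [1⋯ p ] ∷ []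
single-strip⇒[1⋯] {Q} {suc j} ord bij w _ st@(_ , rs) with nonempty w
... | y , rest , Q₁ , refl =
  trans (sym whole) (trans (placeMany-[1⋯] single) (cong (λ k → [1⋯ k ] ∷ []) (+-identityʳ (suc j))))
  where
  open Ordered ord
  open Bijective bij

  y≡1 : y ≡ 1
  y≡1 = bottom-first ord (subst (λ k → Bijective k Q) (sym (+-identityʳ (suc j))) bij) st

  one-row : Wide ((y ∷ rest) ∷ Q₁) → Q₁ ≡ []
  one-row (top _)  = refl
  one-row (_ ∷ w′) with nonempty w′
  ... | u , _ , _ , refl = contradiction
    (subst (u <_) y≡1
      (firstColumn (_ , there here , here) (_ , here , here) (s≤s (s≤s z≤n))))
    (≤⇒≯ (proj₁ (range (_ , there here , here))))

  -- The emptied row remains and serves as `[1⋯ 0 ]`, the filling from which the replay starts.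
  empty : restrict 0 Q ≡ [] ∷ []
  empty = cong₂ _∷_
    (filter-none (_≤? 0) (all-at (y ∷ rest) λ p → <⇒≱ (proj₁ (range (_ , here , p)))))
    (cong (restrict 0) (one-row w))

  whole : restrict (suc j + 0) Q ≡ Q
  whole = restrict-all Q λ {_} {_} {x} b →
    subst (x ≤_) (sym (+-identityʳ (suc j))) (proj₂ (range b))

  single : PlaceMany 1 (suc j) 0 ([1⋯ 0 ] ∷ []) (restrict (suc j + 0) Q)
  single = subst (λ X → PlaceMany 1 (suc j) 0 X (restrict (suc j + 0) Q)) empty
                 (rising⇒placeMany ord bij rs)

bottom-second : Ordered ((suc m ∷ y ∷ row) ∷ Q) → Bijective (2 + l + m) ((suc m ∷ y ∷ row) ∷ Q) →
                IsStart ((suc m ∷ y ∷ row) ∷ Q) m (2 + l) →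
                y ≡ 2 + m × Rising ((suc m ∷ y ∷ row) ∷ Q) 2 (3 + m) l
bottom-second {m} {y} {row} {Q} {l} ord bij (_ , (_ , 0<c) ∷ (_∷_ {d = d} (in-d , c<d) rs))
  with m≤n⇒m<n∨m≡n (Ordered.rows ord (_ , here , here) (_ , here , there here) ≤-refl)
-- Here `y` comes after `2 + m` in the strip, so its column 2 is to the right of the column of
-- `2 + m`, which is itself to the right of the column of `suc m`: impossible.
... | inj₁ m<y =
  contradiction
    (<-≤-trans (≤-<-trans 0<c c<d) (s≤s⁻¹ (rising-late bij rs (_ , here , there here) m<y
      (s≤s (subst (y ≤_) (cong (2 +_) (+-comm l m))
        (proj₂ (Bijective.range bij (_ , here , there here))))))))
    (<-irrefl refl)
... | inj₂ refl =
  refl , subst (λ e → Rising _ e (3 + m) l)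
           (Bijective.column-unique bij in-d (_ , _ , here , there here)) rs

-- The previous filling is `restrict m Q₁`: the bottom row has no entry up to `m`, and the rows
-- above lose exactly the later entries of the strip. Restricting `T` to `2 + m` gives the two-box
-- row on top of which the round starts, and `rising⇒placeMany` replays the rest.
round⁻ : ∀ {rest Q₁} → let T = (suc m ∷ 2 + m ∷ rest) ∷ Q₁ ; T⁻ = restrict m Q₁ in
         Ordered T → Bijective (2 + l + m) T → Rising T 2 (3 + m) l → Wide Q₁ → 0 < m →
         Ordered T⁻ × Bijective m T⁻ × Wide T⁻ ×
         (∀ {x c} → x ≤ m → InColumn T x c → InColumn T⁻ x c) × Step (2 + l) T⁻ T
round⁻ {m} {l} {rest} {Q₁} ord bij rs wide₁ 0<m =
  restrict-ordered ord₁ , bij⁻ , wide-restrict wide₁ small ord₁ , keep ,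
  step (subst (λ k → PlaceMany (3 + k) l 2 ((1 + k ∷ 2 + k ∷ []) ∷ T⁻) T)
              (sym (bijective⇒max bij⁻ 0<m))
              (subst₂ (PlaceMany (3 + m) l 2) before after (rising⇒placeMany ord bij rs)))
  where
  open Bijective bij
  T  = (suc m ∷ 2 + m ∷ rest) ∷ Q₁
  T⁻ = restrict m Q₁

  ord₁ : Ordered Q₁
  ord₁ = ordered-tail ord

  old : T⁻ [ c , r ]= x → T [ c , suc r ]= x × x ≤ m
  old b = let (_ , q , p) , x≤m = restrict-box⁻ ord₁ b in (_ , there q , p) , x≤m

  keep : x ≤ m → InColumn T x c → InColumn T⁻ x c
  keep x≤m (_ , _ , here , p)    = contradiction (bottom-large ord p) (≤⇒≯ x≤m)
  keep x≤m (_ , _ , there q , p) = _ , restrict-box⁺ ord₁ (_ , q , p) x≤m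

  bij⁻ : Bijective m T⁻
  bij⁻ = record
    { range  = λ b → let b′ , x≤m = old b in proj₁ (range b′) , x≤m
    ; exists = λ 0<x x≤m →
        let c , _ , b = exists 0<x (≤-trans x≤m (m≤n+m m (2 + l)))
        in c , keep x≤m (_ , b)
    ; unique = λ b₁ b₂ →
        let c≡d , r≡s = unique (proj₁ (old b₁)) (proj₁ (old b₂)) in c≡d , suc-injective r≡s
    }

  not-in-bottom : Q₁ [ c , r ]= x → T [ d , 1 ]= y → x ≢ y
  not-in-bottom (_ , q , p) b refl =
    <⇒≢ (s≤s (at-positive q)) (proj₂ (unique b (_ , there q , p)))

  -- Entries beyond `2 + m` lie to the right of column 2, while `suc m` and `2 + m` themselves are
  -- in the bottom row.
  small : Q₁ [ e , r ]= y → e ≤ 2 → y ≤ m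
  small {y = y} b@(_ , q , p) e≤2 = s≤s⁻¹ (≤∧≢⇒< (s≤s⁻¹ (≤∧≢⇒< (≮⇒≥ λ 2+m<y →
      <⇒≱ (rising-late bij rs (_ , there q , p) 2+m<y
            (s≤s (subst (y ≤_) (cong (2 +_) (+-comm l m)) (proj₂ (range (_ , there q , p))))))
          e≤2)
    (not-in-bottom b (_ , here , there here))))
    (not-in-bottom b (_ , here , here)))

  bottom-row : filter (_≤? 2 + m) (suc m ∷ 2 + m ∷ rest) ≡ suc m ∷ 2 + m ∷ []
  bottom-row =
    trans (filter-accept (_≤? 2 + m) (n≤1+n (suc m))) (cong (suc m ∷_)
      (trans (filter-accept (_≤? 2 + m) ≤-refl) (cong (2 + m ∷_)
        (filter-none (_≤? 2 + m) (All.map <⇒≱ (all-at rest λ p →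
          Ordered.rows ord (_ , here , there here) (_ , here , there (there p))
            (s≤s (s≤s (at-positive p)))))))))

  before : restrict (2 + m) T ≡ (suc m ∷ 2 + m ∷ []) ∷ T⁻
  before = cong₂ _∷_ bottom-row
    (trans (restrict-suc Q₁ λ b → not-in-bottom b (_ , here , there here))
           (restrict-suc Q₁ λ b → not-in-bottom b (_ , here , here)))

  after : restrict (l + (2 + m)) T ≡ T
  after = restrict-all T λ {_} {_} {x} b →
    subst (x ≤_) (sym (trans (+-suc l (suc m)) (cong suc (+-suc l m)))) (proj₂ (range b))

last-round : Wide Q → Ordered Q → Bijective (2 + l + m) Q → IsStart Q m (2 + l) → 0 < m →
             ∃[ Q⁻ ] (Ordered Q⁻ × Bijective m Q⁻ × Wide Q⁻ ×
                      (∀ {x c} → x ≤ m → InColumn Q x c → InColumn Q⁻ x c) × Step (2 + l) Q⁻ Q)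
last-round (top {row = []} ())
last-round (_∷_ {row = []} () _)
last-round (_∷_ {row = _ ∷ []} (s≤s ()) _)
last-round {l = l} {m} (top {row = _ ∷ _} _) ord bij st 0<m
  with refl ← bottom-first ord bij st
  -- The entry 1 is at most `m`, but in a single row starting with `suc m` all entries exceed `m`.
  with Bijective.exists bij (s≤s z≤n) (≤-trans 0<m (m≤n+m m (2 + l)))
... | _ , _ , _ , here , p = contradiction (bottom-large ord p) (≤⇒≯ 0<m)
last-round (_∷_ {row = _ ∷ _ ∷ _} _ wide₁) ord bij st 0<m
  with refl ← bottom-first ord bij st
  with refl , rs ← bottom-second ord bij st = _ , round⁻ ord bij rs wide₁ 0<m

-- Stated with `IsStart` in place of row strips, so that nothing about maximality has to be proved
-- again for the smaller filling. The induction removes the head of `α`, which is the part of the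
-- last strip.
tableau⇒generated : IsPeak α → All (0 <_) α → 0 < sum α →
                    Ordered Q → Bijective (sum α) Q → Wide Q → Parts (IsStart Q) α → Generated α Q
tableau⇒generated {[]} _ _ () _ _ _ _
tableau⇒generated {p ∷ []} {Q} _ (0<p ∷ []) _ ord bij wide (st ∷ []) =
  subst (Generated (p ∷ []))
    (sym (single-strip⇒[1⋯] ord (subst (λ k → Bijective k Q) (+-identityʳ p) bij) wide 0<p st)) start
tableau⇒generated {zero ∷ q ∷ δ} _ (() ∷ _)
tableau⇒generated {suc zero ∷ q ∷ δ} peak =
  contradiction (peak zero (s≤s (s≤s z≤n))) (<-irrefl refl)
tableau⇒generated {suc (suc l) ∷ α@(q ∷ δ)} peak (_ ∷ 0<α@(0<q ∷ _)) _ ord bij wide (st ∷ sts) =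
  let 0<m = ≤-trans 0<q (m≤m+n q (sum δ))
      _ , ord⁻ , bij⁻ , wide⁻ , keep , last = last-round wide ord bij st 0<m
      -- The earlier strips consist of entries up to `m`, all of which survive in the same columns.
      sts⁻ = parts-map 0<α
        (λ {s} {p} 0<p p+s≤m (first , rs) →
          keep (≤-trans (+-monoˡ-≤ s 0<p) p+s≤m) first ,
          rising-⊆ (λ y< → keep (≤-trans (s≤s⁻¹ y<) (subst (_≤ sum α) (+-comm p s) p+s≤m))) rs)
        sts
  in round (tableau⇒generated (peak-tail peak) 0<α 0<m ord⁻ bij⁻ wide⁻ sts⁻) last

DIRT⇒generated : 0 < n → IsComposition n α → IsPeak α →
                 IsDIRT n Q → IsPeak (shape Q) → HasRowStripShape n Q (reverse α) → Generated α Q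
DIRT⇒generated {α = α} {Q} 0<n record { positive = 0<α ; total = refl }
               peak dirt peak-shape hasShape =
  tableau⇒generated peak 0<α 0<n
    (record { rows = rows ; firstColumn = firstColumn ; triple = triple }) bij
    (peak⇒wide 0<rows (IsComposition.positive composition) peak-shape)
    (parts-map 0<α (λ _ _ → rowStrips⇒starts bij strips)
      (prefixes⇒parts α (HasRowStripShape.strip hasShape)))
  where
  open IsDIRT dirt

  bij : Bijective (sum α) Q
  bij = standard⇒bijective standard

  0<rows : 0 < length Q
  0<rows with Bijective.exists bij 0<n ≤-refl
  ... | _ , _ , _ , here    , _ = s≤s z≤n
  ... | _ , _ , _ , there _ , _ = s≤s z≤n

proposition4p18 : ∀ (n : ℕ) → 0 < n → ∀ (α : List ℕ) → IsComposition n α → IsPeak α →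
    ∀ (Q : Filling) →
    Generated α Q ⇔ (IsDIRT n Q × IsPeak (shape Q) × HasRowStripShape n Q (reverse α))
proposition4p18 n 0<n α comp peak Q =
  mk⇔ (generated⇒DIRT comp)
      (λ (dirt , peak-shape , hasShape) → DIRT⇒generated 0<n comp peak dirt peak-shape hasShape)
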